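{- For every $A\subseteq\mathbb{N}$ that is not computably enumerable, the represented space $H_A$ is finite and computably Hausdorff, but not computably discrete.
   Context: A represented space $\mathbf{X}=(X,\delta_{\mathbf{X}})$ is a set $X$ with a partial surjection $\delta_{\mathbf{X}}:\subseteq\mathbb{N}^{\mathbb{N}}\to X$; any $p$ with $\delta_{\mathbf X}(p)=x$ is a name of $x$. A map $f:\mathbf{X}\to\mathbf{Y}$ is computable if some computable partial map on $\mathbb{N}^{\mathbb{N}}$ sends every name of every $x\in X$ to a name of $f(x)$. In the product $\mathbf{X}\times\mathbf{Y}$, $p$ names $(x,y)$ iff $n\mapsto p(2n)$ names $x$ and $n\mapsto p(2n+1)$ names $y$. Sierpinski space $\mathbb{S}=\{\top,\bot\}$ is represented so that $0^\omega$ names $\bot$ and every other sequence names $\top$. A subset of $\mathbf{X}$ is computably open if its characteristic function $\mathbf{X}\to\mathbb{S}$ (value $\top$ exactly on the set) is computable, and computably closed if its complement is computably open. $\mathbf{X}$ is computably discrete (computably Hausdorff) if the diagonal $\{(x,x)\}\subseteq\mathbf{X}\times\mathbf{X}$ is computably open (computably closed). An enumeration of a set $B\subseteq\mathbb{N}$ is a sequence $s:\mathbb{N}\to\mathbb{N}\uplus\{\bot\}$ with $B=\{s_n\mid n\in\mathbb{N},\ s_n\neq\bot\}$ (coded as an element of $\mathbb{N}^{\mathbb{N}}$, e.g. with $0$ for $\bot$ and $k+1$ for $k$). For non-empty $A\subsetneq\mathbb{N}$, $H_A$ is the represented space with underlying set $\{a,b\}$ (two distinct points) in which a name for $a$ is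 some $n\notin A$ followed by an enumeration of $A$, and a name for $b$ is some $n\in A$ followed by an enumeration of some (possibly empty) $B\subseteq\mathbb{N}\setminus A$. (A set that is not computably enumerable is automatically non-empty and different from $\mathbb{N}$.) -}

module Defs where

open import Axiom.ExcludedMiddle using (ExcludedMiddle)
open import Data.Empty using (⊥; ⊥-elim)
open import Data.Fin.Base using (Fin)
open import Data.Nat.Base using (ℕ; zero; suc; _+_; _*_; _<_)
open import Data.Nat.Properties using (+-suc; suc-injective; 1+n≢0)
open import Data.Product.Base using (_×_; _,_; ∃; ∃-syntax; proj₁; proj₂)
open import Data.Unit.Base using (⊤)
open import Data.Vec.Base using (Vec; []; _∷_; [_]; lookup)
open import Data.Vec.Relation.Binary.Pointwise.Inductive using (Pointwise; []; _∷_)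
open import Function.Base using (_∘_)
open import Function.Bundles using (_↔_; _⇔_)
open import Level using (0ℓ)
open import Relation.Binary.PropositionalEquality
  using (_≡_; refl; sym; trans; cong; cong₂; subst; _≗_)
open import Relation.Nullary.Decidable.Core using (yes; no; decidable-stable)
open import Relation.Nullary.Negation.Core using (¬_)
open import Relation.Unary
  using (Pred; _∈_; _∉_; _⊆_; _≐_; ∁; Empty; Universal)

-- Partial recursive functions relative to a family of oracles ℕ → ℕ indexed
-- by O.  With O = ⊥ these are the ordinary partial recursive functions.

data Code (O : Set) : ℕ → Set where
  zeroᶜ   : Code O 0
  sucᶜ    : Code O 1
  projᶜ   : ∀ {n} → Fin n → Code O n
  oracleᶜ : O → Code O 1
  compᶜ   : ∀ {k n} → Code O k → Vec (Code O n) k → Code O n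
  precᶜ   : ∀ {n} → Code O n → Code O (suc (suc n)) → Code O (suc n)
  minᶜ    : ∀ {n} → Code O (suc n) → Code O n

-- ρ ⊢ c ⟨ xs ⟩⇓ y : with oracles ρ, c halts on xs with value y.

data _⊢_⟨_⟩⇓_ {O : Set} (ρ : O → ℕ → ℕ) :
       ∀ {n} → Code O n → Vec ℕ n → ℕ → Set where
  ⇓zero   : ρ ⊢ zeroᶜ ⟨ [] ⟩⇓ 0
  ⇓suc    : ∀ {x} → ρ ⊢ sucᶜ ⟨ [ x ] ⟩⇓ suc x
  ⇓proj   : ∀ {n} {i : Fin n} {xs} → ρ ⊢ projᶜ i ⟨ xs ⟩⇓ lookup xs i
  ⇓oracle : ∀ {o x} → ρ ⊢ oracleᶜ o ⟨ [ x ] ⟩⇓ ρ o x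
  ⇓comp   : ∀ {k n} {c : Code O k} {ds : Vec (Code O n) k} {xs ys z} →
            Pointwise (λ d y → ρ ⊢ d ⟨ xs ⟩⇓ y) ds ys →
            ρ ⊢ c ⟨ ys ⟩⇓ z →
            ρ ⊢ compᶜ c ds ⟨ xs ⟩⇓ z
  ⇓prec0  : ∀ {n} {c : Code O n} {d xs y} →
            ρ ⊢ c ⟨ xs ⟩⇓ y →
            ρ ⊢ precᶜ c d ⟨ 0 ∷ xs ⟩⇓ y
  ⇓precS  : ∀ {n} {c : Code O n} {d xs m r y} →
            ρ ⊢ precᶜ c d ⟨ m ∷ xs ⟩⇓ r →
            ρ ⊢ d ⟨ m ∷ r ∷ xs ⟩⇓ y →
            ρ ⊢ precᶜ c d ⟨ suc m ∷ xs ⟩⇓ y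
  ⇓min    : ∀ {n} {c : Code O (suc n)} {xs y} →
            ρ ⊢ c ⟨ y ∷ xs ⟩⇓ 0 →
            (∀ i → i < y → ∃[ k ] ρ ⊢ c ⟨ i ∷ xs ⟩⇓ suc k) →
            ρ ⊢ minᶜ c ⟨ xs ⟩⇓ y

Baire : Set
Baire = ℕ → ℕ

ComputableSequence : Pred Baire 0ℓ
ComputableSequence s = ∃[ c ] (∀ n → ⊥-elim ⊢ c ⟨ [ n ] ⟩⇓ s n)

-- The graph of the computable partial map on Baire space given by a code with
-- a single oracle: it is defined at p iff the code halts on every input.

_⟦_⟧≃_ : Code ⊤ 1 → Baire → Baire → Set
c ⟦ p ⟧≃ q = ∀ n → (λ _ → p) ⊢ c ⟨ [ n ] ⟩⇓ q n

-- The set enumerated by s, where 0 codes "no element" and suc k codes k.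
-- Every sequence enumerates exactly one set.

Enumerated : Baire → Pred ℕ 0ℓ
Enumerated s k = ∃[ n ] s n ≡ suc k

ComputablyEnumerable : Pred ℕ 0ℓ → Set
ComputablyEnumerable A = ∃[ s ] ComputableSequence s × Enumerated s ≐ A

-- The partial surjection δ is given by its graph: p names x iff δ(p) = x.
-- Without function extensionality, invariance under ≗ has to be required.

record RepresentedSpace : Set₁ where
  field
    Carrier    : Set
    _names_    : Baire → Carrier → Set
    respects   : ∀ {p q x} → p ≗ q → p names x → q names x
    functional : ∀ {p x y} → p names x → p names y → x ≡ y
    surjective : ∀ x → ∃[ p ] p names x

open RepresentedSpace public using (Carrier)
open RepresentedSpace

Computable : (X Y : RepresentedSpace) → (Carrier X → Carrier Y) → Set
Computable X Y f =
  ∃[ c ] (∀ p x → _names_ X p x → ∃[ q ] c ⟦ p ⟧≃ q × _names_ Y q (f x))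

evens odds : Baire → Baire
evens p n = p (2 * n)
odds  p n = p (suc (2 * n))

interleave : Baire → Baire → Baire
interleave p q zero    = p 0
interleave p q (suc n) = interleave q (p ∘ suc) n

private
  2*suc : ∀ n → 2 * suc n ≡ suc (suc (2 * n))
  2*suc n = cong suc (+-suc n (n + 0))

evens-interleave : ∀ p q → p ≗ evens (interleave p q)
evens-interleave p q zero    = refl
evens-interleave p q (suc n) =
  trans (evens-interleave (p ∘ suc) (q ∘ suc) n)
        (cong (interleave p q) (sym (2*suc n)))

odds-interleave : ∀ p q → q ≗ odds (interleave p q)
odds-interleave p q = evens-interleave q (p ∘ suc)

infixr 2 _×ʳ_

_×ʳ_ : RepresentedSpace → RepresentedSpace → RepresentedSpace
X ×ʳ Y = record
  { Carrier    = Carrier X × Carrier Y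
  ; _names_    = λ p (x , y) → _names_ X (evens p) x × _names_ Y (odds p) y
  ; respects   = λ p≗q (u , v) →
      respects X (λ n → p≗q (2 * n)) u , respects Y (λ n → p≗q (suc (2 * n))) v
  ; functional = λ (u , v) (u′ , v′) →
      cong₂ _,_ (functional X u u′) (functional Y v v′)
  ; surjective = λ (x , y) →
      let p , u = surjective X x
          q , v = surjective Y y
      in interleave p q
       , respects X (evens-interleave p q) u
       , respects Y (odds-interleave p q) v
  }

data SierpińskiPoint : Set where
  ⊤ˢ ⊥ˢ : SierpińskiPoint

SierpińskiName : Baire → SierpińskiPoint → Set
SierpińskiName p ⊥ˢ = ∀ n → p n ≡ 0
SierpińskiName p ⊤ˢ = ¬ (∀ n → p n ≡ 0)

𝕊 : RepresentedSpace
𝕊 = record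
  { Carrier    = SierpińskiPoint
  ; _names_    = SierpińskiName
  ; respects   = resp
  ; functional = func
  ; surjective = surj
  }
  where
  resp : ∀ {p q x} → p ≗ q → SierpińskiName p x → SierpińskiName q x
  resp {x = ⊤ˢ} p≗q u q≡0 = u (λ n → trans (p≗q n) (q≡0 n))
  resp {x = ⊥ˢ} p≗q u n   = trans (sym (p≗q n)) (u n)

  func : ∀ {p x y} → SierpińskiName p x → SierpińskiName p y → x ≡ y
  func {x = ⊤ˢ} {⊤ˢ} u v = refl
  func {x = ⊤ˢ} {⊥ˢ} u v = ⊥-elim (u v)
  func {x = ⊥ˢ} {⊤ˢ} u v = ⊥-elim (v u)
  func {x = ⊥ˢ} {⊥ˢ} u v = refl

  surj : ∀ x → ∃[ p ] SierpińskiName p x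
  surj ⊤ˢ = (λ _ → 1) , (λ 1≡0 → 1+n≢0 (1≡0 0))
  surj ⊥ˢ = (λ _ → 0) , (λ _ → refl)

ComputablyOpen : (X : RepresentedSpace) → Pred (Carrier X) 0ℓ → Set
ComputablyOpen X U = ∃[ χ ] (∀ x → χ x ≡ ⊤ˢ ⇔ x ∈ U) × Computable X 𝕊 χ

ComputablyClosed : (X : RepresentedSpace) → Pred (Carrier X) 0ℓ → Set
ComputablyClosed X U = ComputablyOpen X (∁ U)

Diagonal : (X : RepresentedSpace) → Pred (Carrier (X ×ʳ X)) 0ℓ
Diagonal X (x , y) = x ≡ y

ComputablyDiscrete : RepresentedSpace → Set
ComputablyDiscrete X = ComputablyOpen (X ×ʳ X) (Diagonal X)

ComputablyHausdorff : RepresentedSpace → Set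
ComputablyHausdorff X = ComputablyClosed (X ×ʳ X) (Diagonal X)

Finite : RepresentedSpace → Set
Finite X = ∃[ n ] (Carrier X ↔ Fin n)

data HPoint : Set where
  a b : HPoint

-- The enumeration part of a name is p ∘ suc.  For b, "an enumeration of some
-- B ⊆ ∁ A" says that the unique set enumerated by p ∘ suc is contained in ∁ A.

HName : Pred ℕ 0ℓ → Baire → HPoint → Set
HName A p a = p 0 ∉ A × Enumerated (p ∘ suc) ≐ A
HName A p b = p 0 ∈ A × Enumerated (p ∘ suc) ⊆ ∁ A

-- Excluded middle provides the names: an arbitrary A need not have an
-- enumeration ℕ → ℕ constructively.

module _ (em : ExcludedMiddle 0ℓ) where

  H : (A : Pred ℕ 0ℓ) → ¬ Empty A → ¬ Universal A → RepresentedSpace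
  H A A≢∅ A≢ℕ = record
    { Carrier    = HPoint
    ; _names_    = HName A
    ; respects   = resp
    ; functional = func
    ; surjective = surj
    }
    where
    transport : ∀ {s t} → s ≗ t → Enumerated s ⊆ Enumerated t
    transport s≗t (n , eq) = n , trans (sym (s≗t n)) eq

    resp : ∀ {p q x} → p ≗ q → HName A p x → HName A q x
    resp {x = a} p≗q (p₀∉A , to , from) =
      (λ q₀∈A → p₀∉A (subst A (sym (p≗q 0)) q₀∈A)) ,
      (λ k∈ → to (transport (sym ∘ p≗q ∘ suc) k∈)) ,
      (λ k∈A → transport (p≗q ∘ suc) (from k∈A))
    resp {x = b} p≗q (p₀∈A , disjoint) =
      subst A (p≗q 0) p₀∈A ,
      (λ k∈ → disjoint (transport (sym ∘ p≗q ∘ suc) k∈))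

    func : ∀ {p x y} → HName A p x → HName A p y → x ≡ y
    func {x = a} {a} u v = refl
    func {x = a} {b} u v = ⊥-elim (proj₁ u (proj₁ v))
    func {x = b} {a} u v = ⊥-elim (proj₁ v (proj₁ u))
    func {x = b} {b} u v = refl

    element : ∃[ n ] n ∈ A
    element = decidable-stable em (λ ¬∃ → A≢∅ (λ n n∈A → ¬∃ (n , n∈A)))

    nonElement : ∃[ n ] n ∉ A
    nonElement = decidable-stable em
      (λ ¬∃ → A≢ℕ (λ n → decidable-stable em (λ n∉A → ¬∃ (n , n∉A))))

    enum : Baire
    enum n with em {n ∈ A}
    ... | yes _ = suc n
    ... | no  _ = 0

    enum⊆A : Enumerated enum ⊆ A
    enum⊆A (n , eq) with em {n ∈ A}
    ... | yes n∈A = subst A (suc-injective eq) n∈A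
    enum⊆A (n , ()) | no _

    A⊆enum : A ⊆ Enumerated enum
    A⊆enum {k} k∈A = k , lemma
      where
      lemma : enum k ≡ suc k
      lemma with em {k ∈ A}
      ... | yes _  = refl
      ... | no k∉A = ⊥-elim (k∉A k∈A)

    infixr 5 _◂_

    _◂_ : ℕ → Baire → Baire
    (n ◂ p) zero    = n
    (n ◂ p) (suc m) = p m

    surj : ∀ x → ∃[ p ] HName A p x
    surj a = proj₁ nonElement ◂ enum , proj₂ nonElement , enum⊆A , A⊆enum
    surj b = proj₁ element ◂ (λ _ → 0) , proj₂ element , λ { (_ , ()) }

¬ce⇒¬empty : ∀ {A} → ¬ ComputablyEnumerable A → ¬ Empty A
¬ce⇒¬empty ¬ce empty = ¬ce
  ( (λ _ → 0)
  , (compᶜ zeroᶜ [] , λ _ → ⇓comp [] ⇓zero)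
  , (λ { (_ , ()) })
  , (λ {k} k∈A → ⊥-elim (empty k k∈A))
  )

¬ce⇒¬universal : ∀ {A} → ¬ ComputablyEnumerable A → ¬ Universal A
¬ce⇒¬universal ¬ce universal = ¬ce
  ( suc
  , (sucᶜ , λ _ → ⇓suc)
  , (λ {k} _ → universal k)
  , (λ {k} _ → k , refl)
  )

{-# OPTIONS --safe #-}

-- Hausdorff: names (m , s) and (n , t) denote different points iff s
-- enumerates n or t enumerates m.
-- Not discrete: let c semidecide equality on H_A and fix n₀ ∈ A.  If m ∈ A then
-- m 0^ω is a name of b, so c accepts (n₀ 0^ω , m 0^ω).  If m ∉ A then every
-- prefix of m 0^ω extends to a name of a, so by continuity c cannot accept.
-- Hence A would be the domain of a partial recursive function.  Evaluating with
-- a step bound, which also bounds the queries to the oracle, yields both the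
-- continuity and a total computable enumeration of that domain.
module Submission where

open import Defs
open import Axiom.ExcludedMiddle using (ExcludedMiddle)
open import Data.Empty using (⊥; ⊥-elim)
open import Data.Fin.Base using (Fin; zero; suc)
open import Data.Nat.Base
  using (ℕ; zero; suc; pred; _+_; _∸_; _≤_; _<_; _⊔_; z≤n; s≤s; s≤s⁻¹; >-nonZero)
open import Data.Nat.Induction using (<-rec)
open import Data.Nat.Properties
open import Data.Product.Base using (_×_; _,_; ∃-syntax; proj₁; proj₂; map₂)
open import Data.Sum.Base using (inj₁; inj₂)
open import Data.Unit.Base using (⊤; tt)
open import Data.Vec.Base using (Vec; []; _∷_; [_]; lookup; map; tabulate; tail)
open import Data.Vec.Properties using (tabulate∘lookup)
open import Data.Vec.Relation.Binary.Pointwise.Inductive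
  using (Pointwise; []; _∷_; tabulate⁺)
open import Function.Base using (_∘_; case_of_)
open import Function.Bundles using (_↔_; mk↔ₛ′; mk⇔; Equivalence)
open import Level using (0ℓ)
open import Relation.Binary.PropositionalEquality
  using (_≡_; _≢_; refl; sym; trans; cong; cong₂; subst)
open import Relation.Nullary.Decidable.Core using (decidable-stable)
open import Relation.Nullary.Negation.Core using (¬_; contradiction)
open import Relation.Unary using (Pred; _∈_; _∉_; _⊆_; _≐_)

open RepresentedSpace using (_names_; respects; surjective)

-- Primitive recursion and the coding of partial values.

rec : ℕ → (ℕ → ℕ → ℕ) → ℕ → ℕ
rec z s zero    = z
rec z s (suc n) = s n (rec z s n)

rec-+ : ∀ m n → rec n (λ _ r → suc r) m ≡ m + n
rec-+ zero    n = refl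
rec-+ (suc m) n = cong suc (rec-+ m n)

rec-∸ : ∀ m n → rec m (λ _ r → pred r) n ≡ m ∸ n
rec-∸ m zero    = refl
rec-∸ m (suc n) = trans (cong pred (rec-∸ m n)) (pred[m∸n]≡m∸[1+n] m n)

-- Values of partial functions are coded with 0 for "undefined" and suc y for y.
guard : ℕ → ℕ → ℕ
guard n y = rec 0 (λ _ _ → y) n

guard⁻ : ∀ n {y z} → guard n y ≡ suc z → n ≡ suc (pred n) × y ≡ suc z
guard⁻ (suc n) eq = refl , eq

guard⁺ : ∀ {n k y} → n ≡ suc k → guard n y ≡ y
guard⁺ refl = refl

guard-∸ : ∀ {m n y} → m < n → guard (n ∸ m) y ≡ y
guard-∸ {m} {n} m<n = guard⁺ (sym (suc-pred (n ∸ m) {{>-nonZero (m<n⇒0<n∸m m<n)}}))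

guards : ∀ {k} → Vec ℕ k → ℕ → ℕ
guards []       y = y
guards (n ∷ ns) y = guard n (guards ns y)

guards-suc : ∀ {k} (ys : Vec ℕ k) {z} → guards (map suc ys) z ≡ z
guards-suc []       = refl
guards-suc (y ∷ ys) = guards-suc ys

map-pred-suc : ∀ {k} (ys : Vec ℕ k) → map pred (map suc ys) ≡ ys
map-pred-suc []       = refl
map-pred-suc (y ∷ ys) = cong (y ∷_) (map-pred-suc ys)

-- Yields 0, `x` or `y` for `n` equal to 0, 1 or larger, that is, for a coded value that is
-- undefined, zero or positive.
case₃ : ℕ → ℕ → ℕ → ℕ
case₃ n x y = rec 0 (λ i _ → rec x (λ _ _ → y) i) n

-- Total computable functions

-- Uniformity is the point: a single code has to work for every oracle family `ρ i`.
record Total {I O : Set} (ρ : I → O → ℕ → ℕ) {n} (f : I → Vec ℕ n → ℕ) : Set where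
  constructor _by_
  field
    code   : Code O n
    halts  : ∀ i xs → ρ i ⊢ code ⟨ xs ⟩⇓ f i xs

record Totals {I O : Set} (ρ : I → O → ℕ → ℕ) {n k}
              (σ : I → Vec ℕ n → Vec ℕ k) : Set where
  constructor _by_
  field
    codes  : Vec (Code O n) k
    halt   : ∀ i xs → Pointwise (λ c y → ρ i ⊢ c ⟨ xs ⟩⇓ y) codes (σ i xs)

open Total
open Totals

module _ {I O : Set} {ρ : I → O → ℕ → ℕ} where

  private variable
    n k : ℕ
    f g h : I → Vec ℕ n → ℕ
    σ : I → Vec ℕ n → Vec ℕ k

  total-resp : (∀ i xs → f i xs ≡ g i xs) → Total ρ f → Total ρ g
  total-resp f≗g (c by p) = c by λ i xs → subst (ρ i ⊢ c ⟨ xs ⟩⇓_) (f≗g i xs) (p i xs)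

  infixr 5 _∷ᵗ_

  []ᵗ : Totals ρ {n} (λ _ _ → [])
  []ᵗ = [] by λ _ _ → []

  _∷ᵗ_ : Total ρ f → Totals ρ σ → Totals ρ (λ i xs → f i xs ∷ σ i xs)
  (c by p) ∷ᵗ (cs by ps) = (c ∷ cs) by λ i xs → p i xs ∷ ps i xs

  idᵗ : Totals ρ {n} (λ _ xs → xs)
  idᵗ = tabulate projᶜ by λ i xs →
    subst (Pointwise (λ c y → ρ i ⊢ c ⟨ xs ⟩⇓ y) (tabulate projᶜ))
          (tabulate∘lookup xs) (tabulate⁺ (λ _ → ⇓proj))

  tailᵗ : Totals ρ {n} {suc k} σ → Totals ρ (λ i xs → tail (σ i xs))
  tailᵗ (cs by ps) = tail cs by λ i xs → pointwise-tail (ps i xs)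
    where
    pointwise-tail : ∀ {n k} {R : Code O n → ℕ → Set}
                     {cs : Vec (Code O n) (suc k)} {ys : Vec ℕ (suc k)} →
                     Pointwise R cs ys → Pointwise R (tail cs) (tail ys)
    pointwise-tail (_ ∷ ps) = ps

  compᵗ : Total ρ f → Totals ρ {n} σ → Total ρ (λ i xs → f i (σ i xs))
  compᵗ (c by p) (cs by ps) = compᶜ c cs by λ i xs → ⇓comp (ps i xs) (p i _)

  varᵗ : (j : Fin n) → Total ρ (λ _ xs → lookup xs j)
  varᵗ j = projᶜ j by λ _ _ → ⇓proj

  weaken : Total ρ f → Total ρ (λ i xs → f i (tail xs))
  weaken p = compᵗ p (tailᵗ idᵗ)

  sucᵗ : Total ρ {n} f → Total ρ (λ i xs → suc (f i xs))
  sucᵗ (c by p) = compᶜ sucᶜ (c ∷ []) by λ i xs → ⇓comp (p i xs ∷ []) ⇓suc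

  oracleᵗ : (o : O) → Total ρ {n} f → Total ρ (λ i xs → ρ i o (f i xs))
  oracleᵗ o (c by p) = compᶜ (oracleᶜ o) (c ∷ []) by λ i xs → ⇓comp (p i xs ∷ []) ⇓oracle

  constᵗ : (m : ℕ) → Total ρ {n} (λ _ _ → m)
  constᵗ zero    = compᶜ zeroᶜ [] by λ _ _ → ⇓comp [] ⇓zero
  constᵗ (suc m) = sucᵗ (constᵗ m)

  recᵗ : Total ρ f → Total ρ g → Total ρ h →
         Total ρ {n} (λ i xs → rec (f i xs) (λ j r → g i (j ∷ r ∷ xs)) (h i xs))
  recᵗ {f = f} {g} (c by p) (d by q) (e by r) =
    compᶜ (precᶜ c d) (e ∷ codes idᵗ) by λ i xs →
      ⇓comp (r i xs ∷ halt idᵗ i xs) (go i xs _)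
    where
    go : ∀ i xs m →
         ρ i ⊢ precᶜ c d ⟨ m ∷ xs ⟩⇓ rec (f i xs) (λ j r → g i (j ∷ r ∷ xs)) m
    go i xs zero    = ⇓prec0 (p i xs)
    go i xs (suc m) = ⇓precS (go i xs m) (q i _)

  predᵗ : Total ρ {n} f → Total ρ (λ i xs → pred (f i xs))
  predᵗ {f = f} p = total-resp (λ i xs → rec-pred (f i xs)) (recᵗ (constᵗ 0) (varᵗ zero) p)
    where
    rec-pred : ∀ m → rec 0 (λ j _ → j) m ≡ pred m
    rec-pred zero    = refl
    rec-pred (suc m) = refl

  +ᵗ : Total ρ {n} f → Total ρ g → Total ρ (λ i xs → f i xs + g i xs)
  +ᵗ {f = f} {g} p q =
    total-resp (λ i xs → rec-+ (f i xs) (g i xs)) (recᵗ q (sucᵗ (varᵗ (suc zero))) p)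

  ∸ᵗ : Total ρ {n} f → Total ρ g → Total ρ (λ i xs → f i xs ∸ g i xs)
  ∸ᵗ {f = f} {g} p q =
    total-resp (λ i xs → rec-∸ (f i xs) (g i xs)) (recᵗ p (predᵗ (varᵗ (suc zero))) q)

  case₃ᵗ : Total ρ {n} f → Total ρ g → Total ρ h →
           Total ρ (λ i xs → case₃ (f i xs) (g i xs) (h i xs))
  case₃ᵗ p q r =
    recᵗ (constᵗ 0)
         (recᵗ (weaken (weaken q)) (weaken (weaken (weaken (weaken r)))) (varᵗ zero)) p

  guardᵗ : Total ρ {n} f → Total ρ g → Total ρ (λ i xs → guard (f i xs) (g i xs))
  guardᵗ p q = recᵗ (constᵗ 0) (weaken (weaken q)) p

-- Evaluation with a step bound

-- The state of an unbounded search for the first index with value 0, after t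
-- steps: 0 = an undefined value was met, 1 = still searching, 2 + y = found y.
scan : (ℕ → ℕ) → ℕ → ℕ
scan v = rec 1 (λ t r → case₃ r (case₃ (v t) (suc (suc t)) 1) r)

-- The outer `suc` expresses that the value is defined, the inner one that it is positive.
NonzeroBelow : (ℕ → ℕ) → ℕ → Set
NonzeroBelow v t = ∀ i → i < t → ∃[ k ] v i ≡ suc (suc k)

nonzeroBelow-suc : ∀ {v t k} → NonzeroBelow v t → v t ≡ suc (suc k) → NonzeroBelow v (suc t)
nonzeroBelow-suc {v} below eq i i<1+t with m≤n⇒m<n∨m≡n (s≤s⁻¹ i<1+t)
... | inj₁ i<t  = below i i<t
... | inj₂ refl = _ , eq

ScanState : (ℕ → ℕ) → ℕ → ℕ → Set
ScanState v t 0             = ⊤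
ScanState v t 1             = NonzeroBelow v t
ScanState v t (suc (suc y)) = v y ≡ 1 × NonzeroBelow v y

scan-sound : ∀ v t → ScanState v t (scan v t)
scan-sound v zero    = λ _ ()
scan-sound v (suc t) with scan v t | scan-sound v t
... | 0           | _      = tt
... | suc (suc y) | found  = found
... | 1           | below with v t in eq
...   | 0           = tt
...   | 1           = eq , below
...   | suc (suc k) = nonzeroBelow-suc {v} below eq

scan-searching : ∀ v t → NonzeroBelow v t → scan v t ≡ 1
scan-searching v zero    below = refl
scan-searching v (suc t) below
  rewrite scan-searching v t (λ i i<t → below i (m<n⇒m<1+n i<t))
        | proj₂ (below t (n<1+n t)) = refl

scan-found : ∀ v y t → v y ≡ 1 → NonzeroBelow v y → y < t → scan v t ≡ suc (suc y)
scan-found v y (suc t) eq below y<1+t with m≤n⇒m<n∨m≡n (s≤s⁻¹ y<1+t)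
... | inj₁ y<t rewrite scan-found v y t eq below y<t = refl
... | inj₂ refl rewrite scan-searching v y below | eq = refl

module _ {O : Set} where

  -- Queries to the oracle at arguments ≥ s are undefined.
  mutual
    eval : (O → ℕ → ℕ) → ℕ → ∀ {n} → Code O n → Vec ℕ n → ℕ
    eval ρ s zeroᶜ        xs = 1
    eval ρ s sucᶜ         xs = suc (suc (lookup xs zero))
    eval ρ s (projᶜ i)    xs = suc (lookup xs i)
    eval ρ s (oracleᶜ o)  xs = guard (s ∸ lookup xs zero) (suc (ρ o (lookup xs zero)))
    eval ρ s (compᶜ c ds) xs =
      -- An undefined argument turns into a spurious 0 under `pred`; `guards` then discards the
      -- result.
      guards (evals ρ s ds xs) (eval ρ s c (map pred (evals ρ s ds xs)))
    eval ρ s (precᶜ c d)  xs =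
      rec (eval ρ s c (tail xs))
          (λ j r → guard r (eval ρ s d (j ∷ pred r ∷ tail xs)))
          (lookup xs zero)
    -- `pred` sends the states 0 and 1 to "undefined" and the state `2 + y` to the code of `y`.
    eval ρ s (minᶜ c)     xs = pred (scan (λ i → eval ρ s c (i ∷ xs)) s)

    evals : (O → ℕ → ℕ) → ℕ → ∀ {n k} → Vec (Code O n) k → Vec ℕ n → Vec ℕ k
    evals ρ s []       xs = []
    evals ρ s (d ∷ ds) xs = eval ρ s d xs ∷ evals ρ s ds xs

  AgreeBelow : ℕ → (ρ ρ′ : O → ℕ → ℕ) → Set
  AgreeBelow s ρ ρ′ = ∀ o x → x < s → ρ o x ≡ ρ′ o x

  module _ {ρ ρ′ : O → ℕ → ℕ} {s : ℕ} (agree : AgreeBelow s ρ ρ′) where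

    mutual
      -- Continuity: a successful evaluation has queried arguments below `s` only, so the
      -- computation is valid for every oracle that agrees there.
      eval-sound : ∀ {n} (c : Code O n) xs {y} → eval ρ s c xs ≡ suc y → ρ′ ⊢ c ⟨ xs ⟩⇓ y
      eval-sound zeroᶜ        []       refl = ⇓zero
      eval-sound sucᶜ         (x ∷ []) refl = ⇓suc
      eval-sound (projᶜ i)    xs       refl = ⇓proj
      eval-sound (oracleᶜ o)  (x ∷ []) eq with guard⁻ (s ∸ x) eq
      ... | s∸x≡1+ , refl =
        subst (ρ′ ⊢ oracleᶜ o ⟨ [ x ] ⟩⇓_)
              (sym (agree o x (m∸n≢0⇒n<m (λ s∸x≡0 → 0≢1+n (trans (sym s∸x≡0) s∸x≡1+)))))
              ⇓oracle
      eval-sound (compᶜ c ds) xs       eq =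
        let args , eq′ = evals-sound ds xs eq
        in ⇓comp args (eval-sound c _ eq′)
      eval-sound (precᶜ c d)  (m ∷ xs) eq = go m eq
        where
        go : ∀ m {y} → eval ρ s (precᶜ c d) (m ∷ xs) ≡ suc y → ρ′ ⊢ precᶜ c d ⟨ m ∷ xs ⟩⇓ y
        go zero    eq = ⇓prec0 (eval-sound c xs eq)
        go (suc m) eq =
          let r-eq , eq′ = guard⁻ (eval ρ s (precᶜ c d) (m ∷ xs)) eq
          in ⇓precS (go m r-eq) (eval-sound d _ eq′)
      eval-sound (minᶜ c)     xs       eq
        with scan (λ i → eval ρ s c (i ∷ xs)) s | scan-sound (λ i → eval ρ s c (i ∷ xs)) s
      eval-sound (minᶜ c) xs refl | suc (suc y) | eq , below =
        ⇓min (eval-sound c _ eq) (λ i i<y → map₂ (eval-sound c _) (below i i<y))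

      evals-sound : ∀ {n k} (ds : Vec (Code O n) k) xs {z y} →
                    guards (evals ρ s ds xs) z ≡ suc y →
                    Pointwise (λ d v → ρ′ ⊢ d ⟨ xs ⟩⇓ v) ds (map pred (evals ρ s ds xs)) ×
                    z ≡ suc y
      evals-sound []       xs eq = [] , eq
      evals-sound (d ∷ ds) xs eq =
        let d-eq , eq′ = guard⁻ (eval ρ s d xs) eq
            args , eq″ = evals-sound ds xs eq′
        in eval-sound d xs d-eq ∷ args , eq″

-- Completeness of bounded evaluation.

-- Asking for all large bounds instead of a single one lets the bounds of subcomputations be
-- combined by a maximum, without a separate proof that `eval` is monotone.
Eventually : (ℕ → Set) → Set
Eventually P = ∃[ N ] (∀ n → N ≤ n → P n)

eventually-map : ∀ {P Q : ℕ → Set} → (∀ {n} → P n → Q n) → Eventually P → Eventually Q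
eventually-map f (N , p) = N , λ n N≤n → f (p n N≤n)

eventually-zip : ∀ {P Q R : ℕ → Set} → (∀ {n} → P n → Q n → R n) →
                 Eventually P → Eventually Q → Eventually R
eventually-zip f (M , p) (N , q) =
  M ⊔ N , λ n M⊔N≤n → f (p n (m⊔n≤o⇒m≤o M N M⊔N≤n)) (q n (m⊔n≤o⇒n≤o M N M⊔N≤n))

eventually-below : ∀ {P : ℕ → ℕ → Set} m → (∀ i → i < m → Eventually (P i)) →
                   Eventually (λ n → ∀ i → i < m → P i n)
eventually-below zero    p = 0 , λ _ _ _ ()
eventually-below {P} (suc m) p =
  eventually-zip
    (λ {n} below here i i<1+m → case m≤n⇒m<n∨m≡n (s≤s⁻¹ i<1+m) of λ where
      (inj₁ i<m)  → below i i<m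
      (inj₂ refl) → here)
    (eventually-below m (λ i i<m → p i (m<n⇒m<1+n i<m)))
    (p m (n<1+n m))

module _ {O : Set} {ρ : O → ℕ → ℕ} where

  mutual
    eval-complete : ∀ {n} {c : Code O n} {xs y} → ρ ⊢ c ⟨ xs ⟩⇓ y →
                    Eventually (λ s → eval ρ s c xs ≡ suc y)
    eval-complete ⇓zero = 0 , λ _ _ → refl
    eval-complete ⇓suc  = 0 , λ _ _ → refl
    eval-complete ⇓proj = 0 , λ _ _ → refl
    eval-complete {c = oracleᶜ o} {x ∷ []} ⇓oracle =
      suc x , λ _ x<s → guard-∸ x<s
    eval-complete {c = compᶜ c ds} {xs} {z} (⇓comp {ys = ys} args body) =
      eventually-zip (λ {s} → combine {s}) (evals-complete args) (eval-complete body)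
      where
      combine : ∀ {s} → evals ρ s ds xs ≡ map suc ys → eval ρ s c ys ≡ suc z →
                eval ρ s (compᶜ c ds) xs ≡ suc z
      combine eq eq′ rewrite eq | map-pred-suc ys = trans (guards-suc ys) eq′
    eval-complete (⇓prec0 base) = eval-complete base
    eval-complete {c = precᶜ c d} {suc m ∷ xs} (⇓precS {r = r} {y} before step) =
      eventually-zip (λ {s} → combine {s}) (eval-complete before) (eval-complete step)
      where
      combine : ∀ {s} → eval ρ s (precᶜ c d) (m ∷ xs) ≡ suc r →
                eval ρ s d (m ∷ r ∷ xs) ≡ suc y →
                eval ρ s (precᶜ c d) (suc m ∷ xs) ≡ suc y
      combine eq eq′ rewrite eq = eq′
    eval-complete {c = minᶜ c} {xs} {y} (⇓min found below) =
      eventually-zip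
        (λ {s} y<s (eq , below′) →
          cong pred (scan-found (λ i → eval ρ s c (i ∷ xs)) y s eq below′ y<s))
        -- The search inspects the indices below `s`, so it reaches `y` only if `y < s`.
        (suc y , λ _ y<s → y<s)
        (eventually-zip _,_ (eval-complete found)
          (eventually-below y (λ i i<y →
            let k , halts = below i i<y in eventually-map (k ,_) (eval-complete halts))))

    evals-complete : ∀ {n k} {ds : Vec (Code O n) k} {xs ys} →
                     Pointwise (λ d y → ρ ⊢ d ⟨ xs ⟩⇓ y) ds ys →
                     Eventually (λ s → evals ρ s ds xs ≡ map suc ys)
    evals-complete []           = 0 , λ _ _ → refl
    evals-complete (arg ∷ args) =
      eventually-zip (cong₂ _∷_) (eval-complete arg) (evals-complete args)

  -- At a common large bound, `eval` returns the value of both derivations.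
  ⇓-functional : ∀ {n} {c : Code O n} {xs y z} → ρ ⊢ c ⟨ xs ⟩⇓ y → ρ ⊢ c ⟨ xs ⟩⇓ z → y ≡ z
  ⇓-functional p q =
    let N , eq = eventually-zip (λ eq eq′ → suc-injective (trans (sym eq) eq′))
                                (eval-complete p) (eval-complete q)
    in eq N ≤-refl

-- Computability of the evaluator.

-- In the arguments of the evaluator's code, 0 is the step bound and 1 is the
-- parameter of the oracle.
module _ {O : Set} {I P : Set} {π : I → P → ℕ → ℕ} (ρ : ℕ → O → ℕ → ℕ)
         (ρᵗ : ∀ o → Total π {2} (λ _ xs → ρ (lookup xs (suc zero)) o (lookup xs zero))) where

  mutual
    evalᵗ : ∀ {n} (c : Code O n) →
            Total π (λ _ v → eval (ρ (lookup v (suc zero))) (lookup v zero) c (tail (tail v)))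
    evalᵗ zeroᶜ        = constᵗ 1
    evalᵗ sucᶜ         = sucᵗ (sucᵗ (weaken (weaken (varᵗ zero))))
    evalᵗ (projᶜ i)    = sucᵗ (weaken (weaken (varᵗ i)))
    evalᵗ (oracleᶜ o)  =
      guardᵗ (∸ᵗ (varᵗ zero) query) (sucᵗ (compᵗ (ρᵗ o) (query ∷ᵗ varᵗ (suc zero) ∷ᵗ []ᵗ)))
      where query = weaken (weaken (varᵗ zero))
    evalᵗ (compᶜ c ds) =
      guard-evalsᵗ ds (compᵗ (evalᵗ c) (varᵗ zero ∷ᵗ varᵗ (suc zero) ∷ᵗ pred-evalsᵗ ds))
    evalᵗ (precᶜ c d)  =
      recᵗ (compᵗ (evalᵗ c) (varᵗ zero ∷ᵗ varᵗ (suc zero) ∷ᵗ tailᵗ (tailᵗ (tailᵗ idᵗ))))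
           (guardᵗ (varᵗ (suc zero))
             -- Inside the recursion, index and previous value occupy 0 and 1, so the step bound and
             -- the oracle parameter move to 2 and 3.
             (compᵗ (evalᵗ d)
               (weaken (weaken (varᵗ zero)) ∷ᵗ weaken (weaken (varᵗ (suc zero))) ∷ᵗ
                varᵗ zero ∷ᵗ predᵗ (varᵗ (suc zero)) ∷ᵗ
                tailᵗ (tailᵗ (tailᵗ (tailᵗ (tailᵗ idᵗ)))))))
           (weaken (weaken (varᵗ zero)))
    evalᵗ (minᶜ c)     =
      predᵗ
        (recᵗ (constᵗ 1)
          (case₃ᵗ (varᵗ (suc zero))
            (case₃ᵗ
              (compᵗ (evalᵗ c)
                (weaken (weaken (varᵗ zero)) ∷ᵗ weaken (weaken (varᵗ (suc zero))) ∷ᵗ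
                 varᵗ zero ∷ᵗ tailᵗ (tailᵗ (tailᵗ (tailᵗ idᵗ)))))
              (sucᵗ (sucᵗ (varᵗ zero)))
              (constᵗ 1))
            (varᵗ (suc zero)))
          (varᵗ zero))

    guard-evalsᵗ : ∀ {n k} (ds : Vec (Code O n) k) {f : I → Vec ℕ (suc (suc n)) → ℕ} →
      Total π f →
      Total π (λ i v →
        guards (evals (ρ (lookup v (suc zero))) (lookup v zero) ds (tail (tail v))) (f i v))
    guard-evalsᵗ []       p = p
    guard-evalsᵗ (d ∷ ds) p = guardᵗ (evalᵗ d) (guard-evalsᵗ ds p)

    pred-evalsᵗ : ∀ {n k} (ds : Vec (Code O n) k) →
      Totals π (λ _ v →
        map pred (evals (ρ (lookup v (suc zero))) (lookup v zero) ds (tail (tail v))))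
    pred-evalsᵗ []       = []ᵗ
    pred-evalsᵗ (d ∷ ds) = predᵗ (evalᵗ d) ∷ᵗ pred-evalsᵗ ds

-- Scheduling for the dovetailed search.

-- 0, 0, 0, 1, 0, 1, 2, 3, 0, … counts up from 0 at N and restarts at 2N, so every
-- value recurs infinitely often.
sawtooth : ℕ → ℕ
sawtooth = rec 0 (λ n r → guard ((n ∸ r) ∸ suc r) (suc r))

sawtoothᵗ : ∀ {I O : Set} {ρ : I → O → ℕ → ℕ} {n} {f : I → Vec ℕ n → ℕ} →
            Total ρ f → Total ρ (λ i xs → sawtooth (f i xs))
sawtoothᵗ =
  recᵗ (constᵗ 0)
       (guardᵗ (∸ᵗ (∸ᵗ (varᵗ zero) (varᵗ (suc zero))) (sucᵗ (varᵗ (suc zero))))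
               (sucᵗ (varᵗ (suc zero))))

module _ {N : ℕ} (reset : sawtooth N ≡ 0) where

  -- At position `i + N` with value `i`, subtracting the value from the position recovers `N`, so
  -- the guard tests `suc i < N`.
  sawtooth-rise : ∀ i → i < N → sawtooth (i + N) ≡ i
  sawtooth-rise zero    _   = reset
  sawtooth-rise (suc i) i<N
    rewrite sawtooth-rise i (<⇒≤ i<N) | m+n∸m≡n i N =
    guard-∸ i<N

sawtooth-reset : ∀ N → sawtooth (suc N) ≡ 0 → sawtooth (suc N + suc N) ≡ 0
sawtooth-reset N reset
  rewrite sawtooth-rise reset N (n<1+n N) | m+n∸m≡n N (suc N) | n∸n≡0 N = refl

sawtooth-resets : ∀ m → ∃[ N ] m ≤ N × sawtooth (suc N) ≡ 0
sawtooth-resets zero    = 0 , z≤n , refl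
sawtooth-resets (suc m) =
  let N , m≤N , reset = sawtooth-resets m
  in N + suc N ,
     ≤-trans (s≤s m≤N) (m≤n+m (suc N) N) ,
     sawtooth-reset N reset

-- A reset at `suc N` is followed by all values up to `N`; it suffices to take `N` beyond both `m`
-- and `k`.
sawtooth-recurs : ∀ m k → ∃[ n ] m ≤ n × sawtooth n ≡ k
sawtooth-recurs m k =
  let N , m⊔k≤N , reset = sawtooth-resets (m ⊔ k)
  in k + suc N ,
     ≤-trans (m⊔n≤o⇒m≤o m k m⊔k≤N) (≤-trans (n≤1+n N) (m≤n+m (suc N) k)) ,
     sawtooth-rise reset k (s≤s (m⊔n≤o⇒n≤o m k m⊔k≤N))

-- Equality test and semidecision that two points differ.

match : ℕ → ℕ → ℕ
match x y = 1 ∸ ((x ∸ y) + (y ∸ x))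

match-refl : ∀ x → match x x ≡ 1
match-refl x rewrite n∸n≡0 x = refl

match-≢ : ∀ {x y} → x ≢ y → match x y ≡ 0
match-≢ {x} {y} x≢y = m≤n⇒m∸n≡0 (n≢0⇒n>0 λ sum≡0 → x≢y (≤-antisym
  (m∸n≡0⇒m≤n (m+n≡0⇒m≡0 (x ∸ y) sum≡0))
  (m∸n≡0⇒m≤n (m+n≡0⇒n≡0 (x ∸ y) sum≡0))))

matchᵗ : ∀ {I O : Set} {ρ : I → O → ℕ → ℕ} {n} {f g : I → Vec ℕ n → ℕ} →
         Total ρ f → Total ρ g → Total ρ (λ i xs → match (f i xs) (g i xs))
matchᵗ p q = ∸ᵗ (constᵗ 1) (+ᵗ (∸ᵗ p q) (∸ᵗ q p))

-- Positive iff entry `n` of one enumeration lists the head of the other name. Enumerations start at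
-- index 1 of a name, and `k` is listed as `suc k`.
hits : Baire → ℕ → ℕ
hits p n = match (suc (odds p 0)) (evens p (suc n)) + match (suc (evens p 0)) (odds p (suc n))

hitsᵗ : Total {I = Baire} {O = ⊤} (λ p _ → p) {1} (λ p xs → hits p (lookup xs zero))
hitsᵗ =
  +ᵗ (matchᵗ (sucᵗ (oracleᵗ tt (constᵗ 1))) (oracleᵗ tt double))
     (matchᵗ (sucᵗ (oracleᵗ tt (constᵗ 0))) (oracleᵗ tt (sucᵗ double)))
  -- Definitionally `2 * suc n`, so the queries match `evens` and `odds` without rewriting.
  where double = +ᵗ (sucᵗ (varᵗ zero)) (+ᵗ (sucᵗ (varᵗ zero)) (constᵗ 0))

-- Names with delayed or empty enumerations.

infixr 5 _◂_

_◂_ : ℕ → Baire → Baire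
(n ◂ p) zero    = n
(n ◂ p) (suc m) = p m

-- As 0 codes "no element", the enumerated set is unchanged, while the first `s` entries look like
-- those of an empty enumeration.
delay : ℕ → Baire → Baire
delay zero    p = p
delay (suc s) p = 0 ◂ delay s p

delay-< : ∀ {s p m} → m < s → delay s p m ≡ 0
delay-< {suc s} {m = zero}  _   = refl
delay-< {suc s} {m = suc m} m<s = delay-< (s≤s⁻¹ m<s)

delay-+ : ∀ s {p} m → delay s p (s + m) ≡ p m
delay-+ zero    m = refl
delay-+ (suc s) m = delay-+ s m

enumerated-delay : ∀ s p → Enumerated (delay s p) ≐ Enumerated p
enumerated-delay s p = to s , λ (n , eq) → s + n , trans (delay-+ s n) eq
  where
  to : ∀ s → Enumerated (delay s p) ⊆ Enumerated p
  to zero    k∈             = k∈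
  to (suc s) (suc n , eq)   = to s (n , eq)

-- The bound `n` is crude, but it survives the induction, in which the two sequences swap roles.
interleave-cong : ∀ {p p′ q q′} n → (∀ i → i ≤ n → p i ≡ p′ i) → (∀ i → i ≤ n → q i ≡ q′ i) →
                  interleave p q n ≡ interleave p′ q′ n
interleave-cong zero    p≗p′ q≗q′ = p≗p′ 0 z≤n
interleave-cong (suc n) p≗p′ q≗q′ =
  interleave-cong n (λ i i≤n → q≗q′ i (m≤n⇒m≤1+n i≤n)) (λ i i≤n → p≗p′ (suc i) (s≤s i≤n))

interleave-names : ∀ X Y p q x y → _names_ X p x → _names_ Y q y →
                   _names_ (X ×ʳ Y) (interleave p q) (x , y)
interleave-names X Y p q x y u v =
  respects X (evens-interleave p q) u , respects Y (odds-interleave p q) v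

zeros : Baire
zeros _ = 0

-- The oracle of the simulation: it names `(b , b)` if both numbers are in `A`, and it is computable
-- uniformly in `n` in any case.
bareNames : ℕ → ℕ → Baire
bareNames m n = interleave (m ◂ zeros) (n ◂ zeros)

bareNamesᵗ : ∀ m → Total {I = ⊤} {O = ⊥} (λ _ → ⊥-elim) {2}
               (λ _ xs → bareNames m (lookup xs (suc zero)) (lookup xs zero))
bareNamesᵗ m =
  total-resp (λ { _ (x ∷ n ∷ []) → rec-bareNames n x })
    -- Case distinction on the position: `m` at 0, `n` at 1, and 0 beyond.
    (recᵗ (constᵗ m) (recᵗ (varᵗ (suc (suc (suc zero)))) (constᵗ 0) (varᵗ zero)) (varᵗ zero))
  where
  interleave-zeros : ∀ x → interleave zeros zeros x ≡ 0
  interleave-zeros zero    = refl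
  interleave-zeros (suc x) = interleave-zeros x

  rec-bareNames : ∀ n x → rec m (λ i _ → rec n (λ _ _ → 0) i) x ≡ bareNames m n x
  rec-bareNames n zero          = refl
  rec-bareNames n (suc zero)    = refl
  rec-bareNames n (suc (suc x)) = sym (interleave-zeros x)

-- Finiteness, Hausdorffness and failure of discreteness.

HPoint↔Fin2 : HPoint ↔ Fin 2
HPoint↔Fin2 = mk↔ₛ′
  (λ { a → zero ; b → suc zero })
  (λ { zero → a ; (suc zero) → b })
  (λ { zero → refl ; (suc zero) → refl })
  (λ { a → refl ; b → refl })

distinct : HPoint × HPoint → SierpińskiPoint
distinct (a , a) = ⊥ˢ
distinct (a , b) = ⊤ˢ
distinct (b , a) = ⊤ˢ
distinct (b , b) = ⊥ˢ

module _ (em : ExcludedMiddle 0ℓ) (A : Pred ℕ 0ℓ) (¬ce : ¬ ComputablyEnumerable A) where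

  private
    H-A : RepresentedSpace
    H-A = H em A (¬ce⇒¬empty ¬ce) (¬ce⇒¬universal ¬ce)

  hausdorff : ComputablyHausdorff H-A
  hausdorff = distinct , distinct⇔≢ , code hitsᵗ , λ p xy p-names-xy →
    hits p , (λ n → halts hitsᵗ p [ n ]) , hits-names p xy p-names-xy
    where
    distinct⇔≢ : ∀ xy → _
    distinct⇔≢ (a , a) = mk⇔ (λ ()) (λ a≢a → contradiction refl a≢a)
    distinct⇔≢ (a , b) = mk⇔ (λ _ ()) (λ _ → refl)
    distinct⇔≢ (b , a) = mk⇔ (λ _ ()) (λ _ → refl)
    distinct⇔≢ (b , b) = mk⇔ (λ ()) (λ b≢b → contradiction refl b≢b)

    miss : ∀ {k s n} → ¬ Enumerated s k → match (suc k) (s n) ≡ 0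
    miss k∉s = match-≢ (λ eq → k∉s (_ , sym eq))

    hit : ∀ {k s} → Enumerated s k → ∃[ n ] match (suc k) (s n) ≡ 1
    hit {k} (n , eq) = n , trans (cong (match (suc k)) eq) (match-refl (suc k))

    -- A name of `a` has its head outside `A` and lists exactly `A`; a name of `b` has its head in
    -- `A` and lists only numbers outside. Equal points thus never produce a hit, whereas for
    -- different points the head belonging to `b` gets listed by the name of `a`.
    hits-names : ∀ p xy → _names_ (H-A ×ʳ H-A) p xy → SierpińskiName (hits p) (distinct xy)
    hits-names p (a , a) ((p₀∉A , enum-p) , (q₀∉A , enum-q)) n =
      cong₂ _+_ (miss (q₀∉A ∘ proj₁ enum-p)) (miss (p₀∉A ∘ proj₁ enum-q))
    hits-names p (b , b) ((p₀∈A , enum-p) , (q₀∈A , enum-q)) n =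
      cong₂ _+_ (miss (λ q₀∈p → enum-p q₀∈p q₀∈A)) (miss (λ p₀∈q → enum-q p₀∈q p₀∈A))
    hits-names p (a , b) ((_ , enum-p) , (q₀∈A , _)) hits≡0 =
      let n , eq = hit (proj₂ enum-p q₀∈A)
      in 0≢1+n (trans (sym (m+n≡0⇒m≡0 _ (hits≡0 n))) eq)
    hits-names p (b , a) ((p₀∈A , _) , (_ , enum-q)) hits≡0 =
      let n , eq = hit (proj₂ enum-q p₀∈A)
      in 0≢1+n (trans
           (sym (m+n≡0⇒n≡0 (match (suc (odds p 0)) (evens p (suc n))) (hits≡0 n))) eq)

  not-discrete : ¬ ComputablyDiscrete H-A
  not-discrete (χ , χ⇔≡ , c , c-computes) = ¬ce (enum , enum-computable , enum⊆A , A⊆enum)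
    where
    isZeroᵗ : Total {I = Baire} {O = ⊤} (λ p _ → p) {1} (λ _ xs → 1 ∸ lookup xs zero)
    isZeroᵗ = ∸ᵗ (constᵗ 1) (varᵗ zero)

    test : Code ⊤ 1
    test = compᶜ (code isZeroᵗ) (c ∷ [])

    -- `test` is 0 exactly where the output of `c` is nonzero, so this search halts iff that output
    -- names `⊤ˢ`.
    accept : Code ⊤ 0
    accept = minᶜ test

    n₀ : ℕ
    n₀ = proj₁ (surjective H-A b) 0

    n₀∈A : n₀ ∈ A
    n₀∈A = proj₁ (proj₂ (surjective H-A b))

    -- Not computable, as `A` is not computably enumerable; it enters only the names used to prove
    -- correctness.
    enum-A : Baire
    enum-A = proj₁ (surjective H-A a) ∘ suc

    bare-b : ∀ {n} → n ∈ A → _names_ H-A (n ◂ zeros) b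
    bare-b n∈A = n∈A , λ { (_ , ()) }

    delayed-a : ∀ {n} s → n ∉ A → _names_ H-A (n ◂ delay s enum-A) a
    delayed-a s n∉A =
      let to , from = enumerated-delay s enum-A
          to′ , from′ = proj₂ (proj₂ (surjective H-A a))
      in n∉A , (λ k∈ → to′ (to k∈)) , (λ k∈A → from (from′ k∈A))

    halts⇒∈diagonal : ∀ {p xy z} → _names_ (H-A ×ʳ H-A) p xy → (λ _ → p) ⊢ accept ⟨ [] ⟩⇓ z →
                      χ xy ≡ ⊤ˢ
    halts⇒∈diagonal {p} {xy} {z} p-names (⇓min (⇓comp (y↓ ∷ []) isZero↓) _)
      with χ xy | c-computes p xy p-names
    ... | ⊤ˢ | _             = refl
    -- Here the output vanishes at `z`, so `test` is 1 there, although the search stopped at `z`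
    -- because `test` is 0.
    ... | ⊥ˢ | q , q↓ , q≡0
      with refl ← trans (⇓-functional y↓ (q↓ z)) (q≡0 z)
      = contradiction (⇓-functional isZero↓ (halts isZeroᵗ p [ 0 ])) 0≢1+n

    ∈diagonal⇒halts : ∀ {p xy} → _names_ (H-A ×ʳ H-A) p xy → χ xy ≡ ⊤ˢ →
                      ∃[ z ] (λ _ → p) ⊢ accept ⟨ [] ⟩⇓ z
    ∈diagonal⇒halts {p} {xy} p-names χ≡⊤ with χ xy | c-computes p xy p-names
    -- A name of `⊤ˢ` is merely not constantly 0, so the argument is classical: if the search
    -- diverged, strong induction would make every entry of `q` zero, since a first nonzero one
    -- would stop the search.
    ... | ⊤ˢ | q , q↓ , q≢0 = decidable-stable em λ diverges →
      q≢0 (<-rec (λ n → q n ≡ 0) (λ n below → q≡0-step n diverges (λ i i<n → below i<n)))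
      where
      test↓ : ∀ n → (λ _ → p) ⊢ test ⟨ [ n ] ⟩⇓ (1 ∸ q n)
      test↓ n = ⇓comp (q↓ n ∷ []) (halts isZeroᵗ p [ q n ])

      q≡0-step : ∀ n → ¬ (∃[ z ] (λ _ → p) ⊢ accept ⟨ [] ⟩⇓ z) →
                 (∀ i → i < n → q i ≡ 0) → q n ≡ 0
      q≡0-step n diverges below with q n in eq
      ... | zero  = refl
      ... | suc k = contradiction
        (n , ⇓min (subst ((λ _ → p) ⊢ test ⟨ [ n ] ⟩⇓_)
                         (trans (cong (1 ∸_) eq) (0∸n≡0 k)) (test↓ n))
                  (λ i i<n → 0 , subst ((λ _ → p) ⊢ test ⟨ [ i ] ⟩⇓_)
                                       (cong (1 ∸_) (below i i<n)) (test↓ i)))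
        diverges

    ρ : ℕ → ⊤ → ℕ → ℕ
    ρ k _ = bareNames n₀ k

    -- Dovetailing: stage `n` tries the candidate `sawtooth n` with step bound `n`, so each
    -- candidate is retried with arbitrarily large bounds.
    enum : Baire
    enum n = guard (eval (ρ (sawtooth n)) n accept []) (suc (sawtooth n))

    enum-computable : ComputableSequence enum
    enum-computable = code enumᵗ , λ n → halts enumᵗ tt [ n ]
      where
      enumᵗ : Total {I = ⊤} {O = ⊥} (λ _ → ⊥-elim) (λ _ xs → enum (lookup xs zero))
      enumᵗ =
        guardᵗ (compᵗ (evalᵗ ρ (λ _ → bareNamesᵗ n₀) accept)
                 (varᵗ zero ∷ᵗ sawtoothᵗ (varᵗ zero) ∷ᵗ []ᵗ))
               (sucᵗ (sawtoothᵗ (varᵗ zero)))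

    enum⊆A : Enumerated enum ⊆ A
    enum⊆A (n , eq) with guard⁻ (eval (ρ (sawtooth n)) n accept []) eq
    ... | halted , refl = decidable-stable em λ k∉A →
      case Equivalence.to (χ⇔≡ (b , a))
             (halts⇒∈diagonal
               -- The delay equals the step bound, so the evaluation cannot tell this name of
               -- `(b , a)` from the bare oracle.
               (interleave-names H-A H-A (n₀ ◂ zeros) (sawtooth n ◂ delay n enum-A) b a
                 (bare-b n₀∈A) (delayed-a n k∉A))
               (eval-sound agree accept [] halted)) of λ ()
      where
      agree : AgreeBelow n (ρ (sawtooth n))
                (λ _ → interleave (n₀ ◂ zeros) (sawtooth n ◂ delay n enum-A))
      agree _ x x<n = interleave-cong x (λ _ _ → refl) λ where
        zero    _   → refl
        (suc i) i<x → sym (delay-< (<-trans i<x x<n))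

    A⊆enum : A ⊆ Enumerated enum
    A⊆enum {k} k∈A =
      let z , accepted = ∈diagonal⇒halts {bareNames n₀ k} {b , b}
            (interleave-names H-A H-A (n₀ ◂ zeros) (k ◂ zeros) b b (bare-b n₀∈A) (bare-b k∈A))
            (Equivalence.from (χ⇔≡ (b , b)) refl)
          N , evaluated = eval-complete accepted
          -- A stage whose candidate is `k` and whose step bound already suffices.
          n , N≤n , sawtooth≡k = sawtooth-recurs N k
      in n , enum-value n sawtooth≡k (evaluated n N≤n)
      where
      enum-value : ∀ n {z} → sawtooth n ≡ k → eval (ρ k) n accept [] ≡ suc z → enum n ≡ suc k
      enum-value n refl eq = guard⁺ eq

corollary36 : (em : ExcludedMiddle 0ℓ) (A : Pred ℕ 0ℓ) (¬ce : ¬ ComputablyEnumerable A) →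
    let H-A = H em A (¬ce⇒¬empty ¬ce) (¬ce⇒¬universal ¬ce) in
    Finite H-A × ComputablyHausdorff H-A × ¬ ComputablyDiscrete H-A
corollary36 em A ¬ce = (2 , HPoint↔Fin2) , hausdorff em A ¬ce , not-discrete em A ¬ce
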